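{- Let $n,p,r$ be nonnegative integers with $2\leqslant r<n-p$. Then $$|\mathcal{P}_{n,p}^{r-1}[n-p\prec 1]|=(p+1)\,|\mathcal{P}_{n+1,p+1}^{r}[n-p\prec 1]|.$$
   Context: A plane tree is a rooted tree in which the children of every vertex are linearly ordered. The degree of a vertex in a rooted tree is its number of children, and a leaf is a vertex of degree zero. A plane tree (or a forest of plane trees) is non-leaf vertex labeled if its leaves are not labeled while all other vertices are labeled. $\mathcal{P}_{n,p}^{r}$ denotes the set of forests of $r$ non-leaf vertex labeled plane trees having $n$ vertices in total, exactly $p$ of which are leaves, the $n-p$ non-leaf vertices being labeled bijectively by $\{1,\ldots,n-p\}$, and with the roots of the $r$ trees being the vertices labeled $1,\ldots,r$ (so in particular every root is a non-leaf). Forests are counted up to isomorphism preserving roots, the orders of children, and labels. A vertex $y$ is a descendant of $x$, written $y\prec x$, if $x$ lies on the path from the root of the tree containing $y$ to $y$. For integers $N,q,s,m$, $\mathcal{P}_{N,q}^{s}[m\prec 1]$ denotes the subset of those forests in $\mathcal{P}_{N,q}^{s}$ in which the vertex labeled $m$ lies in the tree rooted at $1$. -}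

module Defs where

open import Data.Nat.Base using (ℕ; suc; _+_; _∸_)
open import Data.List.Base using (List; []; _∷_; _++_; map; upTo)
open import Data.List.NonEmpty.Base using (List⁺; _∷_)
open import Data.List.Membership.Propositional using (_∈_)
open import Data.List.Relation.Binary.Permutation.Propositional using (_↭_)
open import Data.List.Relation.Unary.Any using (Any)
open import Data.Maybe.Base using (Maybe; just; nothing)
open import Data.Product.Base using (_×_)
open import Data.Refinement using (Refinement-syntax; value)
open import Relation.Binary.PropositionalEquality.Core using (_≡_)

-- A vertex is a leaf exactly when it has no children, so labelled vertices
-- carry a nonempty list of subtrees.  Two terms are equal iff they describe
-- isomorphic trees (preserving root, order of children and labels).
data Tree : Set where
  leaf : Tree
  node : (label : ℕ) (children : List⁺ Tree) → Tree

Forest : Set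
Forest = List Tree

root : Tree → Maybe ℕ
root leaf       = nothing
root (node x _) = just x

mutual
  vertices : Tree → ℕ
  vertices leaf              = 1
  vertices (node _ (t ∷ ts)) = suc (vertices t + verticesᶠ ts)

  verticesᶠ : Forest → ℕ
  verticesᶠ []       = 0
  verticesᶠ (t ∷ ts) = vertices t + verticesᶠ ts

mutual
  leaves : Tree → ℕ
  leaves leaf              = 1
  leaves (node _ (t ∷ ts)) = leaves t + leavesᶠ ts

  leavesᶠ : Forest → ℕ
  leavesᶠ []       = 0
  leavesᶠ (t ∷ ts) = leaves t + leavesᶠ ts

mutual
  labels : Tree → List ℕ
  labels leaf              = []
  labels (node x (t ∷ ts)) = x ∷ labels t ++ labelsᶠ ts

  labelsᶠ : Forest → List ℕ
  labelsᶠ []       = []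
  labelsᶠ (t ∷ ts) = labels t ++ labelsᶠ ts

-- The list 1 , 2 , … , k.
[1⋯_] : ℕ → List ℕ
[1⋯ k ] = map suc (upTo k)

-- The trees of a forest are not ordered among themselves; as their roots are
-- labelled 1 , … , s, listing them by root label is a canonical
-- representation.  In particular the list has length s.
record IsLabelledForest (N q s : ℕ) (F : Forest) : Set where
  field
    roots-are  : map root F ≡ map just [1⋯ s ]
    #vertices  : verticesᶠ F ≡ N
    #leaves    : leavesᶠ F ≡ q
    labels-are : labelsᶠ F ↭ [1⋯ N ∸ q ]

-- 𝒫⟨ N , q , s ⟩ is $\mathcal{P}_{N,q}^{s}$.  Refinement proofs are
-- irrelevant, so elements are equal as soon as the underlying forests are.
𝒫⟨_,_,_⟩ : (N q s : ℕ) → Set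
𝒫⟨ N , q , s ⟩ = [ F ∈ Forest ∣ IsLabelledForest N q s F ]

_liesInTreeRootedAt_within_ : (m x : ℕ) → Forest → Set
m liesInTreeRootedAt x within F = Any (λ t → root t ≡ just x × m ∈ labels t) F

-- $\mathcal{P}_{N,q}^{s}[m \prec 1]$
𝒫⟨_,_,_⟩[_≺1] : (N q s m : ℕ) → Set
𝒫⟨ N , q , s ⟩[ m ≺1] =
  [ F ∈ 𝒫⟨ N , q , s ⟩ ∣ m liesInTreeRootedAt 1 within value F ]

{-# OPTIONS --safe #-}

-- Cut a forest with roots 1, …, r − 1 at the vertex r, leaving a marked leaf in
-- its place and appending the subtree of r as the last tree.  The mark then lies
-- outside the last tree, and n − p stays in the tree of 1 unless it was below r.
-- In that case exchange the labels of the roots 1 and r: now n − p is in the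
-- tree of 1 and the mark is in the last tree.  So every pair of a forest with
-- roots 1, …, r and one of its p + 1 leaves arises exactly once.
module Submission where

open import Defs
open import Data.Nat.Base using (ℕ; _+_; _*_; _∸_; _≤_; _<_)
open import Data.Fin.Base using (Fin)
open import Data.Product.Base using (∃₂; _×_)
open import Function.Bundles using (_↔_)
open import Relation.Binary.PropositionalEquality.Core using (_≡_)

open import Algebra.Bundles using (CommutativeMonoid)
import Algebra.Solver.CommutativeMonoid as CommutativeMonoidSolver
open import Data.Empty using (⊥)
import Data.Fin.Base as Fin
open import Data.Fin.Properties using (toℕ<n; fromℕ<-toℕ; toℕ-fromℕ<; *↔×)
open import Data.Irrelevant using ([_])
open import Data.List.Base using
  (List; []; _∷_; _++_; _∷ʳ_; map; upTo; filter; deduplicate; lookup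
  ; cartesianProductWith; length; initLast; _∷ʳ′_)
open import Data.List.NonEmpty.Base using (List⁺; _∷_; toList)
open import Data.List.Properties using
  (∷-injective; ∷ʳ-injective; ∷ʳ-injectiveˡ; map-++; upTo-∷ʳ; ++-identityʳ)
  renaming (≡-dec to List-≡-dec)
open import Data.List.Membership.Propositional using (_∈_; _∉_)
open import Data.List.Membership.Propositional.Properties using
  (∈-map⁺; ∈-map⁻; ∈-upTo⁺; ∈-upTo⁻; ∈-applyUpTo⁻; ∈-++⁺ˡ; ∈-++⁺ʳ; ∈-++⁻; ∈-∃++
  ; ∈-filter⁺; ∈-filter⁻; ∈-deduplicate⁺; ∈-deduplicate⁻; ∈-lookup; ∈-cartesianProductWith⁺)
open import Data.List.Relation.Binary.Permutation.Propositional using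
  (_↭_; ↭-refl; ↭-sym; ↭-trans; ↭-reflexive; prep; ↭⇒↭ₛ)
open import Data.List.Relation.Binary.Permutation.Propositional.Properties using
  (∈-resp-↭; All-resp-↭; ¬x∷xs↭[]; shift; drop-∷; ++-commutativeMonoid)
import Data.List.Relation.Binary.Permutation.Setoid.Properties as Permutationₛ
open import Data.List.Relation.Unary.All as All using (All; []; _∷_)
import Data.List.Relation.Unary.All.Properties as All
open import Data.List.Relation.Unary.AllPairs.Core using ([]; _∷_)
open import Data.List.Relation.Unary.Any as Any using (Any; here; there)
import Data.List.Relation.Unary.Any.Properties as Any
open import Data.List.Relation.Unary.Unique.Propositional using (Unique)
import Data.List.Relation.Unary.Unique.DecPropositional.Properties as Unique
open import Data.Maybe.Base using (just; nothing)
open import Data.Maybe.Properties using (just-injective) renaming (≡-dec to Maybe-≡-dec)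
open import Data.Nat.Base using (zero; suc; z≤n; s≤s; s≤s⁻¹)
open import Data.Nat.Properties
open import Data.Product.Base using (∃; _,_; proj₁; proj₂)
open import Data.Product.Function.NonDependent.Propositional using (_×-↔_)
open import Data.Refinement using (Refinement; value; _,_; value-injective)
import Data.Vec.Base as Vec
open import Data.Sum.Base using (_⊎_; inj₁; inj₂)
open import Function.Base using (_∘_; const)
open import Function.Bundles using (_⇔_; mk⇔; mk↔ₛ′; Equivalence)
open import Function.Construct.Composition using (_↔-∘_)
open import Function.Construct.Identity using (↔-id)
open import Function.Construct.Symmetry using (↔-sym)
open import Relation.Binary.Definitions using (DecidableEquality)
open import Relation.Binary.PropositionalEquality using
  (refl; sym; trans; cong; cong₂; subst; subst₂; setoid; _≢_)
open import Relation.Nullary using (Dec; yes; no; contradiction)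
open import Relation.Nullary.Decidable using (map′; recompute; _×-dec_)
open import Relation.Unary using (Decidable)

-- Finite counting and bijections between refinements.

module _ {A : Set} where

  lookup-injective : {xs : List A} → Unique xs → ∀ i j → lookup xs i ≡ lookup xs j → i ≡ j
  lookup-injective (_ ∷ _) Fin.zero Fin.zero _ = refl
  lookup-injective {_ ∷ xs} (x∉ ∷ _) Fin.zero (Fin.suc j) eq =
    contradiction eq (All.lookup x∉ (∈-lookup j))
  lookup-injective {_ ∷ xs} (x∉ ∷ _) (Fin.suc i) Fin.zero eq =
    contradiction (sym eq) (All.lookup x∉ (∈-lookup i))
  lookup-injective (_ ∷ u) (Fin.suc i) (Fin.suc j) eq =
    cong Fin.suc (lookup-injective u i j eq)

  -- Filtering and deduplicating `xs` leaves each element satisfying `P` exactly once, so its index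
  -- is the required element of `Fin`. Decidability also recomputes the irrelevant proof held by a
  -- refinement.
  refinement-finite : {P : A → Set} → DecidableEquality A → Decidable P →
    (xs : List A) → (∀ {x} → P x → x ∈ xs) → ∃ λ b → Refinement A P ↔ Fin b
  refinement-finite {P} _≟A_ P? xs complete = length ys , mk↔ₛ′ to from to∘from from∘to
    where
    ys : List A
    ys = deduplicate _≟A_ (filter P? xs)

    ∈ys : ∀ {x} → P x → x ∈ ys
    ∈ys px = ∈-deduplicate⁺ _≟A_ (∈-filter⁺ P? (complete px) px)

    to : Refinement A P → Fin (length ys)
    to (x , [ px ]) = Any.index (∈ys (recompute (P? x) px))

    from : Fin (length ys) → Refinement A P
    from i = lookup ys i ,
      [ proj₂ (∈-filter⁻ P? {xs = xs} (∈-deduplicate⁻ _≟A_ (filter P? xs) (∈-lookup i))) ]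

    from∘to : ∀ x → from (to x) ≡ x
    from∘to (x , [ px ]) =
      value-injective (sym (Any.lookup-index (∈ys (recompute (P? x) px))))

    to∘from : ∀ i → to (from i) ≡ i
    to∘from i = lookup-injective (Unique.deduplicate-! _≟A_ (filter P? xs)) _ _
      (cong value (from∘to (from i)))

-- The codes `m` with `Q (r m)` correspond bijectively to both sides, so one goes back along one leg
-- and forward along the other. The codes will be cuts, the legs gluing and separating.
span-↔ : {A B M : Set} {P : A → Set} {Q : B → Set} → Decidable P → Decidable Q →
  (l : M → A) (r : M → B) →
  (∀ {m} → Q (r m) → P (l m)) →
  (∀ {a} → P a → ∃ λ m → Q (r m) × l m ≡ a) →
  (∀ {b} → Q b → ∃ λ m → r m ≡ b) →
  (∀ {m m′} → Q (r m) → Q (r m′) → l m ≡ l m′ → m ≡ m′) →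
  (∀ {m m′} → r m ≡ r m′ → m ≡ m′) →
  Refinement A P ↔ Refinement B Q
span-↔ {A} {B} {M} {P} {Q} P? Q? l r sound l-surj r-surj l-inj r-inj =
  mk↔ₛ′ to from to∘from from∘to
  where
  lift : (a : A) → .(P a) → ∃ λ m → Q (r m) × l m ≡ a
  lift a pa = l-surj (recompute (P? a) pa)

  colift : (b : B) → .(Q b) → ∃ λ m → Q (r m) × r m ≡ b
  colift b qb with recompute (Q? b) qb
  ... | qb′ with r-surj qb′
  ... | m , refl = m , qb′ , refl

  to : Refinement A P → Refinement B Q
  to (a , [ pa ]) = r (proj₁ (lift a pa)) , [ proj₁ (proj₂ (lift a pa)) ]

  from : Refinement B Q → Refinement A P
  from (b , [ qb ]) = l (proj₁ (colift b qb)) , [ sound (proj₁ (proj₂ (colift b qb))) ]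

  to∘from : ∀ b → to (from b) ≡ b
  to∘from (b , [ qb ]) with colift b qb
  ... | m , qm , refl with lift (l m) (sound qm)
  ... | m′ , qm′ , eq = value-injective (cong r (l-inj qm′ qm eq))

  from∘to : ∀ a → from (to a) ≡ a
  from∘to (a , [ pa ]) with lift a pa
  ... | m , qm , refl with colift (r m) qm
  ... | m′ , _ , eq = value-injective (cong l (r-inj eq))

bounded-pair : {A : Set} {P : A → Set} {k : ℕ} →
  Refinement (A × ℕ) (λ (a , i) → P a × i < k) ↔ (Fin k × Refinement A P)
bounded-pair {A} {P} {k} = mk↔ₛ′ to from to∘from from∘to
  where
  to : Refinement (A × ℕ) (λ (a , i) → P a × i < k) → Fin k × Refinement A P
  to ((a , i) , [ q ]) = Fin.fromℕ< (proj₂ q) , (a , [ proj₁ q ])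

  from : Fin k × Refinement A P → Refinement (A × ℕ) (λ (a , i) → P a × i < k)
  from (i , (a , [ pa ])) = (a , Fin.toℕ i) , [ pa , toℕ<n i ]

  to∘from : ∀ x → to (from x) ≡ x
  to∘from (i , x) = cong (_, x) (fromℕ<-toℕ i (toℕ<n i))

  from∘to : ∀ x → from (to x) ≡ x
  from∘to ((a , i) , [ q ]) = value-injective (cong (a ,_) (toℕ-fromℕ< (proj₂ q)))

-- Decidability of the conditions on forests.

infix 4 _∈?_
_∈?_ : ∀ x (xs : List ℕ) → Dec (x ∈ xs)
x ∈? xs = Any.any? (x ≟_) xs

infix 4 _↭?_
_↭?_ : (xs ys : List ℕ) → Dec (xs ↭ ys)
[]       ↭? []       = yes ↭-refl
[]       ↭? (_ ∷ _)  = no (¬x∷xs↭[] ∘ ↭-sym)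
(x ∷ xs) ↭? ys with x ∈? ys
... | no x∉ys = no λ p → x∉ys (∈-resp-↭ p (here refl))
... | yes x∈ys with ∈-∃++ x∈ys
...   | as , bs , refl = map′
  (λ p → ↭-trans (prep x p) (↭-sym (shift x as bs)))
  (λ p → drop-∷ (↭-trans p (shift x as bs)))
  (xs ↭? as ++ bs)

mutual
  _≟ᵗ_ : DecidableEquality Tree
  leaf ≟ᵗ leaf = yes refl
  leaf ≟ᵗ node _ _ = no λ ()
  node _ _ ≟ᵗ leaf = no λ ()
  node x (t ∷ ts) ≟ᵗ node y (u ∷ us) = map′
    (λ { (refl , refl , refl) → refl })
    (λ { refl → refl , refl , refl })
    (x ≟ y ×-dec t ≟ᵗ u ×-dec ts ≟ᶠ us)

  _≟ᶠ_ : DecidableEquality Forest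
  [] ≟ᶠ [] = yes refl
  [] ≟ᶠ (_ ∷ _) = no λ ()
  (_ ∷ _) ≟ᶠ [] = no λ ()
  (t ∷ ts) ≟ᶠ (u ∷ us) = map′
    (λ { (refl , refl) → refl })
    (λ { refl → refl , refl })
    (t ≟ᵗ u ×-dec ts ≟ᶠ us)

isLabelledForest? : ∀ N q s → Decidable (IsLabelledForest N q s)
isLabelledForest? N q s F = map′
  (λ { (a , b , c , d) → record { roots-are = a ; #vertices = b ; #leaves = c ; labels-are = d } })
  (λ i → IsLabelledForest.roots-are i , IsLabelledForest.#vertices i
       , IsLabelledForest.#leaves i , IsLabelledForest.labels-are i)
  (List-≡-dec (Maybe-≡-dec _≟_) (map root F) (map just [1⋯ s ])
    ×-dec verticesᶠ F ≟ N ×-dec leavesᶠ F ≟ q ×-dec labelsᶠ F ↭? [1⋯ N ∸ q ])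

IsLabelledForest[_≺1] : (m N q s : ℕ) → Forest → Set
IsLabelledForest[ m ≺1] N q s F = IsLabelledForest N q s F × m liesInTreeRootedAt 1 within F

isLabelledForest[_≺1]? : ∀ m N q s → Decidable (IsLabelledForest[ m ≺1] N q s)
isLabelledForest[ m ≺1]? N q s F = isLabelledForest? N q s F
  ×-dec Any.any? (λ t → Maybe-≡-dec _≟_ (root t) (just 1) ×-dec m ∈? labels t) F

flatten : ∀ {N q s m} → 𝒫⟨ N , q , s ⟩[ m ≺1] ↔ Refinement Forest (IsLabelledForest[ m ≺1] N q s)
flatten {N} {q} {s} {m} = mk↔ₛ′ to from (λ _ → refl) (λ _ → refl)
  where
  to : 𝒫⟨ N , q , s ⟩[ m ≺1] → Refinement Forest (IsLabelledForest[ m ≺1] N q s)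
  to ((F , [ i ]) , [ a ]) = F , [ i , a ]

  from : Refinement Forest (IsLabelledForest[ m ≺1] N q s) → 𝒫⟨ N , q , s ⟩[ m ≺1]
  from (F , [ ia ]) = (F , [ proj₁ ia ]) , [ proj₂ ia ]

-- Finiteness of the set of labelled forests.

1≤vertices : ∀ t → 1 ≤ vertices t
1≤vertices leaf = s≤s z≤n
1≤vertices (node _ _) = s≤s z≤n

-- These contain all trees and forests with labels below K and at most d
-- vertices, but also larger ones.
mutual
  trees : (K d : ℕ) → List Tree
  trees K zero    = []
  trees K (suc d) = leaf ∷ cartesianProductWith node (upTo K)
    (cartesianProductWith _∷_ (trees K d) (forests K d))

  forests : (K d : ℕ) → List Forest
  forests K zero    = [] ∷ []
  forests K (suc d) = [] ∷ cartesianProductWith _∷_ (trees K (suc d)) (forests K d)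

mutual
  ∈-trees : ∀ {K} d t → vertices t ≤ d → All (_< K) (labels t) → t ∈ trees K d
  ∈-trees zero t v≤0 _ = contradiction (≤-trans (1≤vertices t) v≤0) λ ()
  ∈-trees (suc d) leaf _ _ = here refl
  ∈-trees (suc d) (node x (t ∷ ts)) (s≤s v≤d) (x<K ∷ <K) = there
    (∈-cartesianProductWith⁺ node (∈-upTo⁺ x<K)
      (∈-cartesianProductWith⁺ _∷_
        (∈-trees d t (≤-trans (m≤m+n _ _) v≤d) (All.++⁻ˡ (labels t) <K))
        (∈-forests d ts (≤-trans (m≤n+m _ (vertices t)) v≤d) (All.++⁻ʳ (labels t) <K))))

  ∈-forests : ∀ {K} d F → verticesᶠ F ≤ d → All (_< K) (labelsᶠ F) → F ∈ forests K d
  ∈-forests zero [] _ _ = here refl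
  ∈-forests (suc d) [] _ _ = here refl
  ∈-forests zero (t ∷ ts) v≤0 _ =
    contradiction (≤-trans (≤-trans (1≤vertices t) (m≤m+n _ _)) v≤0) λ ()
  ∈-forests (suc d) (t ∷ ts) v≤ <K = there
    (∈-cartesianProductWith⁺ _∷_
      (∈-trees (suc d) t (≤-trans (m≤m+n _ _) v≤) (All.++⁻ˡ (labels t) <K))
      -- The first tree uses at least one vertex, so at most `d` remain for the tail.
      (∈-forests d ts (s≤s⁻¹ (≤-trans (+-monoˡ-≤ _ (1≤vertices t)) v≤)) (All.++⁻ʳ (labels t) <K)))

[1⋯]-bounded : ∀ k → All (_< suc k) [1⋯ k ]
[1⋯]-bounded k = All.map⁺ (All.tabulate λ i∈ → s≤s (∈-upTo⁻ i∈))

labelledForests-finite : ∀ m N q s →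
  ∃ λ b → Refinement Forest (IsLabelledForest[ m ≺1] N q s) ↔ Fin b
labelledForests-finite m N q s = refinement-finite _≟ᶠ_ (isLabelledForest[ m ≺1]? N q s)
  -- Labels run up to `N ∸ q` inclusive, while the bound of `forests` is exclusive.
  (forests (suc (N ∸ q)) N)
  λ {F} (isF , _) → ∈-forests N F (≤-reflexive (IsLabelledForest.#vertices isF))
    (All-resp-↭ (↭-sym (IsLabelledForest.labels-are isF)) ([1⋯]-bounded (N ∸ q)))

-- Trees and forests with a hole.

mutual
  data Tree◦ : Set where
    □    : Tree◦
    node : (label : ℕ) (children : Forest◦) → Tree◦

  data Forest◦ : Set where
    here  : Tree◦ → Forest → Forest◦
    there : Tree → Forest◦ → Forest◦

mutual
  plug : Tree◦ → Tree → Tree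
  plug □          t = t
  plug (node x C) t = node x (plug⁺ C t)

  -- A filled forest is never empty, so it can serve as the children of a labelled vertex.
  plug⁺ : Forest◦ → Tree → List⁺ Tree
  plug⁺ (here C F)  t = plug C t ∷ F
  plug⁺ (there u C) t = u ∷ plugᶠ C t

  plugᶠ : Forest◦ → Tree → Forest
  plugᶠ C t = toList (plug⁺ C t)

-- Leaves and their planar order.

mutual
  -- The number of leaves to the left of the hole, which is the zero-based planar position of a leaf
  -- put into it.
  index : Tree◦ → ℕ
  index □          = 0
  index (node _ C) = indexᶠ C

  indexᶠ : Forest◦ → ℕ
  indexᶠ (here C _)  = index C
  indexᶠ (there t C) = leaves t + indexᶠ C

mutual
  index<leaves : ∀ C → index C < leaves (plug C leaf)
  index<leaves □          = s≤s z≤n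
  index<leaves (node _ C) = indexᶠ<leavesᶠ C

  indexᶠ<leavesᶠ : ∀ C → indexᶠ C < leavesᶠ (plugᶠ C leaf)
  indexᶠ<leavesᶠ (here C F)  = ≤-trans (index<leaves C) (m≤m+n _ _)
  indexᶠ<leavesᶠ (there t C) = +-monoʳ-< (leaves t) (indexᶠ<leavesᶠ C)

<-or-≥ : ∀ i m {n} → i < m + n → i < m ⊎ (∃ λ j → j < n × m + j ≡ i)
<-or-≥ i m i<m+n with i <? m
... | yes i<m = inj₁ i<m
... | no i≮m with m≤n⇒∃[o]m+o≡n (≮⇒≥ i≮m)
...   | j , refl = inj₂ (j , +-cancelˡ-< m _ _ i<m+n , refl)

mutual
  -- Together with `index-injective`, this makes a leaf of `t`, a number below `leaves t` and a
  -- context giving `t` when filled by `leaf` the same data.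
  leafAt : ∀ t {i} → i < leaves t → ∃ λ C → plug C leaf ≡ t × index C ≡ i
  leafAt leaf (s≤s z≤n) = □ , refl , refl
  leafAt (node x (t ∷ ts)) i< with leafAt⁺ t ts i<
  ... | C , refl , eq = node x C , refl , eq

  leafAt⁺ : ∀ t ts {i} → i < leaves t + leavesᶠ ts →
    ∃ λ C → plug⁺ C leaf ≡ t ∷ ts × indexᶠ C ≡ i
  leafAt⁺ t ts {i} i< with <-or-≥ i (leaves t) i<
  leafAt⁺ t ts i< | inj₁ i<t with leafAt t i<t
  ... | C , refl , eq = here C ts , refl , eq
  leafAt⁺ t [] i< | inj₂ (_ , () , _)
  leafAt⁺ t (u ∷ us) i< | inj₂ (j , j< , refl) with leafAt⁺ u us j<
  ... | C , refl , refl = there t C , refl , refl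

node-injective : ∀ {x y ts us} → Tree.node x ts ≡ node y us → x ≡ y × ts ≡ us
node-injective refl = refl , refl

mutual
  -- In a forest the index is below the leaf count of the first tree exactly when the hole lies in
  -- that tree, so equal indices send both holes into the same tree.
  index-injective : ∀ C C′ → plug C leaf ≡ plug C′ leaf → index C ≡ index C′ → C ≡ C′
  index-injective □ □ _ _ = refl
  index-injective (node x C) (node y C′) eq i≡ with node-injective eq
  ... | refl , eq′ = cong (node x) (indexᶠ-injective C C′ (cong toList eq′) i≡)

  indexᶠ-injective : ∀ C C′ → plugᶠ C leaf ≡ plugᶠ C′ leaf → indexᶠ C ≡ indexᶠ C′ → C ≡ C′
  indexᶠ-injective (here C F) (here C′ F′) eq i≡ with ∷-injective eq
  ... | eq₁ , refl = cong (λ D → here D F) (index-injective C C′ eq₁ i≡)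
  indexᶠ-injective (here C F) (there t C′) eq i≡ =
    contradiction (subst₂ (λ i u → i < leaves u) i≡ (proj₁ (∷-injective eq)) (index<leaves C))
      (m+n≮m (leaves t) _)
  indexᶠ-injective (there t C) (here C′ F) eq i≡ =
    contradiction
      (subst₂ (λ i u → i < leaves u) (sym i≡) (sym (proj₁ (∷-injective eq))) (index<leaves C′))
      (m+n≮m (leaves t) _)
  indexᶠ-injective (there t C) (there t′ C′) eq i≡ with ∷-injective eq
  ... | refl , eq₂ = cong (there t)
    (indexᶠ-injective C C′ eq₂ (+-cancelˡ-≡ (leaves t) _ _ i≡))

-- Locating a labelled vertex.

mutual
  vertexAt : ∀ {x} t → x ∈ labels t → ∃₂ λ C cs → plug C (node x cs) ≡ t
  vertexAt (node x ts) (here refl) = □ , ts , refl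
  vertexAt (node y (t ∷ ts)) (there x∈) with vertexAt⁺ t ts x∈
  ... | C , cs , refl = node y C , cs , refl

  vertexAt⁺ : ∀ {x} t ts → x ∈ labels t ++ labelsᶠ ts →
    ∃₂ λ C cs → plug⁺ C (node x cs) ≡ t ∷ ts
  vertexAt⁺ t ts x∈ with ∈-++⁻ (labels t) x∈
  vertexAt⁺ t ts x∈ | inj₁ x∈t with vertexAt t x∈t
  ... | C , cs , refl = here C ts , cs , refl
  vertexAt⁺ t [] x∈ | inj₂ ()
  vertexAt⁺ t (u ∷ us) x∈ | inj₂ x∈ts with vertexAt⁺ u us x∈ts
  ... | C , cs , refl = there t C , cs , refl

vertexAtᶠ : ∀ {x} F → x ∈ labelsᶠ F → ∃₂ λ C cs → plugᶠ C (node x cs) ≡ F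
vertexAtᶠ (t ∷ ts) x∈ with vertexAt⁺ t ts x∈
... | C , cs , refl = C , cs , refl

-- Cutting, gluing and marking.

-- Both constructors describe the cut by the position C of r and its subtrees cs;
-- in the swapped case, C is the position within the children of the root 1.
data Cut : Set where
  plain   : (C : Forest◦) (cs : List⁺ Tree) → Cut
  swapped : (C : Forest◦) (cs : List⁺ Tree) (F : Forest) → Cut

position : Cut → Forest◦
position (plain C _)     = C
position (swapped C _ F) = here (node 1 C) F

subtrees : Cut → List⁺ Tree
subtrees (plain _ cs)     = cs
subtrees (swapped _ cs _) = cs

module _ (r : ℕ) where

  glued : Cut → Forest
  glued c = plugᶠ (position c) (node r (subtrees c))

  separated : Cut → Forest
  separated (plain C cs)     = plugᶠ C leaf ∷ʳ node r cs
  -- After the exchange of the two root labels, `cs` hangs below `1`, and the rest of the old tree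
  -- of `1`, with the new leaf, hangs below `r`.
  separated (swapped C cs F) = node 1 cs ∷ F ∷ʳ node r (plug⁺ C leaf)

-- The index of the new leaf in `separated r c`. A swapped cut puts it into the last tree, after all
-- leaves of `node 1 cs ∷ F`.
mark : Cut → ℕ
mark (plain C _)      = indexᶠ C
mark (swapped C cs F) = leavesᶠ (node 1 cs ∷ F) + indexᶠ C

-- Effect of a cut on additive measures.

-- Vertices, leaves and labels are all counted by measures with values in a
-- commutative monoid to which a vertex contributes according to its label.
module _ {c ℓ} (M : CommutativeMonoid c ℓ) where

  open CommutativeMonoid M using
    (Carrier; _≈_; _∙_; ∙-cong; ∙-congˡ; ∙-congʳ; assoc; comm)
    renaming (trans to ≈-trans; setoid to ≈-setoid)

  module Measure
    (w : ℕ → Carrier) (μ : Tree → Carrier) (μᶠ : Forest → Carrier)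
    (μ-node : ∀ x ts → μ (node x ts) ≈ w x ∙ μᶠ (toList ts))
    (μ-∷ : ∀ t ts → μᶠ (t ∷ ts) ≈ μ t ∙ μᶠ ts)
    where

    open import Relation.Binary.Reasoning.Setoid ≈-setoid

    μ-∷ʳ : ∀ F t → μᶠ (F ∷ʳ t) ≈ μᶠ F ∙ μ t
    μ-∷ʳ [] t = begin
      μᶠ (t ∷ [])    ≈⟨ μ-∷ t [] ⟩
      μ t ∙ μᶠ []    ≈⟨ comm _ _ ⟩
      μᶠ [] ∙ μ t    ∎
    μ-∷ʳ (u ∷ us) t = begin
      μᶠ (u ∷ us ∷ʳ t)      ≈⟨ μ-∷ u (us ∷ʳ t) ⟩
      μ u ∙ μᶠ (us ∷ʳ t)    ≈⟨ ∙-congˡ (μ-∷ʳ us t) ⟩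
      μ u ∙ (μᶠ us ∙ μ t)   ≈⟨ assoc _ _ _ ⟨
      μ u ∙ μᶠ us ∙ μ t     ≈⟨ ∙-congʳ (μ-∷ u us) ⟨
      μᶠ (u ∷ us) ∙ μ t     ∎

    private
      under : ∀ {a b x y z f} → a ≈ z ∙ x → b ≈ z ∙ y →
        ∀ {u} → x ∙ f ≈ y ∙ u → a ∙ f ≈ b ∙ u
      under {a} {b} {x} {y} {z} {f} a≈ b≈ {u} eq = begin
        a ∙ f          ≈⟨ ∙-congʳ a≈ ⟩
        z ∙ x ∙ f      ≈⟨ assoc _ _ _ ⟩
        z ∙ (x ∙ f)    ≈⟨ ∙-congˡ eq ⟩
        z ∙ (y ∙ u)    ≈⟨ assoc _ _ _ ⟨
        z ∙ y ∙ u      ≈⟨ ∙-congʳ b≈ ⟨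
        b ∙ u          ∎

    mutual
      -- Adding the other filling to each side avoids measuring contexts separately; every layer
      -- around the hole contributes equally to both sides.
      μ-plug : ∀ C t u → μ (plug C t) ∙ μ u ≈ μ (plug C u) ∙ μ t
      μ-plug □ t u = comm _ _
      μ-plug (node x C) t u = under (μ-node x _) (μ-node x _) (μᶠ-plug C t u)

      μᶠ-plug : ∀ C t u → μᶠ (plugᶠ C t) ∙ μ u ≈ μᶠ (plugᶠ C u) ∙ μ t
      μᶠ-plug (here C F) t u = under
        (≈-trans (μ-∷ _ F) (comm _ _))
        (≈-trans (μ-∷ _ F) (comm _ _))
        (μ-plug C t u)
      μᶠ-plug (there v C) t u = under (μ-∷ v _) (μ-∷ v _) (μᶠ-plug C t u)

    -- A labelled vertex contributes through its label alone, so exchanging the children of two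
    -- roots only permutes the terms.
    μ-swap : ∀ x y C ts F →
      μᶠ (node x (plug⁺ C leaf) ∷ F) ∙ μ (node y ts) ≈
      μᶠ (node x ts ∷ F) ∙ μ (node y (plug⁺ C leaf))
    μ-swap x y C ts F = begin
      μᶠ (node x p ∷ F) ∙ μ (node y ts)
        ≈⟨ ∙-cong (expand p) (μ-node y ts) ⟩
      w x ∙ μᶠ (toList p) ∙ μᶠ F ∙ (w y ∙ μᶠ (toList ts))
        ≈⟨ prove 5 (((X ⊕ P) ⊕ G) ⊕ (Y ⊕ T)) (((X ⊕ T) ⊕ G) ⊕ (Y ⊕ P))
             (w x Vec.∷ μᶠ (toList p) Vec.∷ μᶠ F Vec.∷ w y Vec.∷ μᶠ (toList ts) Vec.∷ Vec.[]) ⟩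
      w x ∙ μᶠ (toList ts) ∙ μᶠ F ∙ (w y ∙ μᶠ (toList p))
        ≈⟨ ∙-cong (expand ts) (μ-node y p) ⟨
      μᶠ (node x ts ∷ F) ∙ μ (node y p) ∎
      where
      open CommutativeMonoidSolver M using (prove; var; _⊕_)
      X = var Fin.zero
      P = var (Fin.suc Fin.zero)
      G = var (Fin.suc (Fin.suc Fin.zero))
      Y = var (Fin.suc (Fin.suc (Fin.suc Fin.zero)))
      T = var (Fin.suc (Fin.suc (Fin.suc (Fin.suc Fin.zero))))
      p = plug⁺ C leaf
      expand : ∀ us → μᶠ (node x us ∷ F) ≈ w x ∙ μᶠ (toList us) ∙ μᶠ F
      expand us = ≈-trans (μ-∷ _ F) (∙-congʳ (μ-node x us))

    -- The cut moves `node r cs` out of its hole at the cost of one new leaf; a swap then only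
    -- redistributes children.
    μ-cut : ∀ r c → μᶠ (glued r c) ∙ μ leaf ≈ μᶠ (separated r c)
    μ-cut r (plain C cs) = begin
      μᶠ (plugᶠ C (node r cs)) ∙ μ leaf     ≈⟨ μᶠ-plug C (node r cs) leaf ⟩
      μᶠ (plugᶠ C leaf) ∙ μ (node r cs)     ≈⟨ μ-∷ʳ (plugᶠ C leaf) (node r cs) ⟨
      μᶠ (plugᶠ C leaf ∷ʳ node r cs)        ∎
    μ-cut r (swapped C cs F) = begin
      μᶠ (glued r (swapped C cs F)) ∙ μ leaf
        ≈⟨ μᶠ-plug (here (node 1 C) F) (node r cs) leaf ⟩
      μᶠ (node 1 (plug⁺ C leaf) ∷ F) ∙ μ (node r cs)
        ≈⟨ μ-swap 1 r C cs F ⟩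
      μᶠ (node 1 cs ∷ F) ∙ μ (node r (plug⁺ C leaf))
        ≈⟨ μ-∷ʳ (node 1 cs ∷ F) (node r (plug⁺ C leaf)) ⟨
      μᶠ (separated r (swapped C cs F)) ∎

module Vertices = Measure +-0-commutativeMonoid (const 1) vertices verticesᶠ
  (λ _ _ → refl) (λ _ _ → refl)
module Leaves = Measure +-0-commutativeMonoid (const 0) leaves leavesᶠ
  (λ _ _ → refl) (λ _ _ → refl)
module Labels = Measure (++-commutativeMonoid {A = ℕ}) (_∷ []) labels labelsᶠ
  (λ _ _ → ↭-refl) (λ _ _ → ↭-refl)

-- Labels and roots of a filled context.

labels-plug : ∀ C t → labels (plug C t) ↭ labels (plug C leaf) ++ labels t
labels-plug C t = ↭-trans (↭-reflexive (sym (++-identityʳ _))) (Labels.μ-plug C t leaf)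

labelsᶠ-plug : ∀ C t → labelsᶠ (plugᶠ C t) ↭ labelsᶠ (plugᶠ C leaf) ++ labels t
labelsᶠ-plug C t = ↭-trans (↭-reflexive (sym (++-identityʳ _))) (Labels.μᶠ-plug C t leaf)

∈-plug : ∀ {x} C {ts} → x ∈ labels (plug C (node x ts))
∈-plug C = ∈-resp-↭ (↭-sym (labels-plug C _)) (∈-++⁺ʳ (labels (plug C leaf)) (here refl))

∈-plugᶠ : ∀ {x} C {ts} → x ∈ labelsᶠ (plugᶠ C (node x ts))
∈-plugᶠ C = ∈-resp-↭ (↭-sym (labelsᶠ-plug C _)) (∈-++⁺ʳ (labelsᶠ (plugᶠ C leaf)) (here refl))

Unique-↭ : {xs ys : List ℕ} → xs ↭ ys → Unique xs → Unique ys
Unique-↭ p = Permutationₛ.Unique-resp-↭ (setoid ℕ) (↭⇒↭ₛ p)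

Unique-++⁻ : ∀ {A : Set} (xs : List A) {ys} → Unique (xs ++ ys) →
  Unique xs × Unique ys × (∀ {x} → x ∈ xs → x ∉ ys)
Unique-++⁻ [] u = [] , u , λ ()
Unique-++⁻ {A} (x ∷ xs) {ys} (x∉ ∷ u) with Unique-++⁻ xs u
... | uxs , uys , disjoint = All.++⁻ˡ xs x∉ ∷ uxs , uys , disjoint′
  where
  disjoint′ : ∀ {y} → y ∈ x ∷ xs → y ∉ ys
  disjoint′ (here refl) y∈ys = All.lookup (All.++⁻ʳ xs x∉) y∈ys refl
  disjoint′ (there y∈)  y∈ys = disjoint y∈ y∈ys

mutual
  -- If the two holes diverged, `x` would label two different vertices of one tree, against
  -- `Unique`.
  plug-injective : ∀ {x ts ts′} C C′ → Unique (labels (plug C (node x ts))) →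
    plug C (node x ts) ≡ plug C′ (node x ts′) → C ≡ C′ × ts ≡ ts′
  plug-injective □ □ _ eq = refl , proj₂ (node-injective eq)
  plug-injective □ (node y C′) (x∉ ∷ _) eq with node-injective eq
  ... | refl , refl = contradiction refl (All.lookup x∉ (∈-plugᶠ C′))
  plug-injective (node y C) □ (x∉ ∷ _) eq with node-injective eq
  ... | refl , refl = contradiction refl (All.lookup x∉ (∈-plugᶠ C))
  plug-injective (node y C) (node z C′) (_ ∷ u) eq with node-injective eq
  ... | refl , eq′ with plugᶠ-injective C C′ u (cong toList eq′)
  ... | refl , refl = refl , refl

  plugᶠ-injective : ∀ {x ts ts′} C C′ → Unique (labelsᶠ (plugᶠ C (node x ts))) →
    plugᶠ C (node x ts) ≡ plugᶠ C′ (node x ts′) → C ≡ C′ × ts ≡ ts′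
  plugᶠ-injective (here C F) (here C′ F′) u eq with ∷-injective eq
  ... | eq₁ , refl with plug-injective C C′ (proj₁ (Unique-++⁻ _ u)) eq₁
  ... | refl , refl = refl , refl
  plugᶠ-injective (here C F) (there t C′) u eq with ∷-injective eq
  ... | eq₁ , refl = contradiction (∈-plugᶠ C′) (proj₂ (proj₂ (Unique-++⁻ _ u)) (∈-plug C))
  plugᶠ-injective (there t C) (here C′ F′) u eq with ∷-injective eq
  ... | refl , refl = contradiction (∈-plugᶠ C) (proj₂ (proj₂ (Unique-++⁻ _ u)) (∈-plug C′))
  plugᶠ-injective (there t C) (there t′ C′) u eq with ∷-injective eq
  ... | refl , eq₂ with plugᶠ-injective C C′ (proj₁ (proj₂ (Unique-++⁻ (labels t) u))) eq₂
  ... | refl , refl = refl , refl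

-- Either the hole is strictly below a root, or it is itself a root position. The second case will
-- be excluded because `nothing` is never a root, and `r` is not a root before the cut.
plugᶠ-roots : ∀ C → (∀ t u → map root (plugᶠ C t) ≡ map root (plugᶠ C u)) ⊎
                    (∀ t → root t ∈ map root (plugᶠ C t))
plugᶠ-roots (here □ F)          = inj₂ λ _ → here refl
plugᶠ-roots (here (node x C) F) = inj₁ λ _ _ → refl
plugᶠ-roots (there t C) with plugᶠ-roots C
... | inj₁ same = inj₁ λ u v → cong (root t ∷_) (same u v)
... | inj₂ root∈ = inj₂ λ u → there (root∈ u)

-- The lists of labels and of roots.

[1⋯]-suc : ∀ s → [1⋯ suc s ] ≡ [1⋯ s ] ∷ʳ suc s
[1⋯]-suc s = trans (cong (map suc) (sym (upTo-∷ʳ s))) (map-++ suc (upTo s) _)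

map-just-[1⋯]-suc : ∀ s → map just [1⋯ suc s ] ≡ map just [1⋯ s ] ∷ʳ just (suc s)
map-just-[1⋯]-suc s = trans (cong (map just) ([1⋯]-suc s)) (map-++ just [1⋯ s ] _)

∈-[1⋯] : ∀ {x k} → 1 ≤ x → x ≤ k → x ∈ [1⋯ k ]
∈-[1⋯] {suc x} _ x<k = ∈-map⁺ suc (∈-upTo⁺ x<k)

[1⋯]-unique : ∀ k → Unique [1⋯ k ]
[1⋯]-unique k = Unique.map⁺ suc-injective (Unique.upTo⁺ k)

just∉[1⋯] : ∀ s → just (suc s) ∉ map just [1⋯ s ]
just∉[1⋯] s p with ∈-map⁻ just p
... | _ , q , refl = n≮n s (s≤s⁻¹ (All.lookup ([1⋯]-bounded s) q))

nothing∉justs : {xs : List ℕ} → nothing ∉ map just xs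
nothing∉justs p with ∈-map⁻ just p
... | _ , _ , ()

-- Membership in the tree of the root 1.

infix 4 _∈₁_
-- Roots are listed in increasing order, so the tree rooted at `1` is the head of the forest.
_∈₁_ : ℕ → Forest → Set
m ∈₁ []      = ⊥
m ∈₁ (t ∷ _) = m ∈ labels t

∈₁⇔liesInTreeRootedAt1 : ∀ {m s F} → map root F ≡ map just [1⋯ suc s ] →
  m ∈₁ F ⇔ m liesInTreeRootedAt 1 within F
∈₁⇔liesInTreeRootedAt1 {m} {s} {t ∷ F} eq with ∷-injective eq
... | root≡1 , eq′ = mk⇔ (λ m∈ → here (root≡1 , m∈)) from
  where
  from : m liesInTreeRootedAt 1 within (t ∷ F) → m ∈ labels t
  from (here (_ , m∈)) = m∈
  -- The roots after the first are at least 2, so no later tree is rooted at `1`.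
  from (there p) with ∈-map⁻ just (subst (just 1 ∈_) eq′ (Any.map⁺ (Any.map (sym ∘ proj₁) p)))
  ... | _ , q , refl with ∈-map⁻ suc q
  ...   | _ , q′ , refl with ∈-applyUpTo⁻ suc q′
  ...     | _ , _ , ()

plugᶠ-∈₁ : ∀ {m} C t → m ∈₁ plugᶠ C leaf → m ∈₁ plugᶠ C t
plugᶠ-∈₁ (here C F)  t m∈ = ∈-resp-↭ (↭-sym (labels-plug C t)) (∈-++⁺ˡ m∈)
plugᶠ-∈₁ (there u C) t m∈ = m∈

-- Recovering a cut from its marked forest.

module _ (r : ℕ) where

  mark<leaves : ∀ c → mark c < leavesᶠ (separated r c)
  mark<leaves (plain C cs) = ≤-trans (indexᶠ<leavesᶠ C)
    (≤-trans (m≤m+n _ _) (≤-reflexive (sym (Leaves.μ-∷ʳ (plugᶠ C leaf) (node r cs)))))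
  mark<leaves (swapped C cs F) = ≤-trans
    (+-monoʳ-< (leavesᶠ (node 1 cs ∷ F)) (indexᶠ<leavesᶠ C))
    (≤-reflexive (sym (Leaves.μ-∷ʳ (node 1 cs ∷ F) (node r (plug⁺ C leaf)))))

  -- Whether the mark lies in the last tree decides the kind of cut; the marked leaf then fixes the
  -- context, and the trees supply the rest.
  separated-injective : ∀ {c c′} → separated r c ≡ separated r c′ → mark c ≡ mark c′ → c ≡ c′
  separated-injective {plain C cs} {plain C′ cs′} eq m≡
    with ∷ʳ-injective (plugᶠ C leaf) (plugᶠ C′ leaf) eq
  ... | eq₁ , refl with indexᶠ-injective C C′ eq₁ m≡
  ...   | refl = refl
  separated-injective {plain C cs} {swapped C′ cs′ F′} eq m≡ =
    contradiction
      (subst₂ (λ i G → i < leavesᶠ G) m≡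
        (proj₁ (∷ʳ-injective (plugᶠ C leaf) (node 1 cs′ ∷ F′) eq)) (indexᶠ<leavesᶠ C))
      (m+n≮m (leavesᶠ (node 1 cs′ ∷ F′)) _)
  separated-injective {swapped C cs F} {plain C′ cs′} eq m≡ =
    contradiction
      (subst₂ (λ i G → i < leavesᶠ G) (sym m≡)
        (sym (proj₁ (∷ʳ-injective (node 1 cs ∷ F) (plugᶠ C′ leaf) eq))) (indexᶠ<leavesᶠ C′))
      (m+n≮m (leavesᶠ (node 1 cs ∷ F)) _)
  separated-injective {swapped C cs F} {swapped C′ cs′ F′} eq m≡
    with ∷ʳ-injective (node 1 cs ∷ F) (node 1 cs′ ∷ F′) eq
  ... | refl , eq₂
    with indexᶠ-injective C C′ (cong toList (proj₂ (node-injective eq₂)))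
           (+-cancelˡ-≡ (leavesᶠ (node 1 cs ∷ F)) _ _ m≡)
  ...   | refl = refl


-- A mark before the last tree gives a plain cut, a mark inside it a swapped one. With at least two
-- roots, the first tree differs from the last and is rooted at `1`, as `swapped` demands.
separated-surjective : ∀ {s F i} → map root F ≡ map just [1⋯ suc (suc s) ] → i < leavesᶠ F →
  ∃ λ c → separated (suc (suc s)) c ≡ F × mark c ≡ i
separated-surjective {s} {F} {i} roots i< with initLast F
separated-surjective {s} {.(F ∷ʳ t)} {i} roots i< | F ∷ʳ′ t
  with ∷ʳ-injective (map root F) (map just [1⋯ suc s ])
         (trans (sym (map-++ root F _)) (trans roots (map-just-[1⋯]-suc (suc s))))
... | rootsF , root-t with t | root-t | <-or-≥ i (leavesᶠ F) (subst (i <_) (Leaves.μ-∷ʳ F t) i<)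
...   | node x cs | refl | inj₁ i<F with F
...     | u ∷ us with leafAt⁺ u us i<F
...       | C , refl , refl = plain C cs , refl , refl
separated-surjective {s} {.(F ∷ʳ t)} {i} roots i< | F ∷ʳ′ t | rootsF , root-t
      | node x (u ∷ us) | refl | inj₂ (j , j< , refl) with leafAt⁺ u us j<
...       | C , refl , refl with F
...         | node y cs ∷ G with ∷-injective rootsF
...           | refl , _ = swapped C cs G , refl , refl

-- Labelled forests under cutting and gluing.

IsLabelledForest-cut : ∀ {n p s c} → let r = suc s in
  map root (separated r c) ≡ map root (glued r c) ∷ʳ just r →
  IsLabelledForest n p s (glued r c) ⇔ IsLabelledForest (n + 1) (p + 1) r (separated r c)
IsLabelledForest-cut {n} {p} {s} {c} roots = mk⇔ to from
  where
  open IsLabelledForest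
  r = suc s

  same-labels : labelsᶠ (glued r c) ↭ labelsᶠ (separated r c)
  same-labels = ↭-trans (↭-reflexive (sym (++-identityʳ _))) (Labels.μ-cut r c)

  -- Vertices and leaves both grow by one, so the set of labels stays the same.
  range : [1⋯ (n + 1) ∸ (p + 1) ] ≡ [1⋯ n ∸ p ]
  range = cong [1⋯_] (cong₂ _∸_ (+-comm n 1) (+-comm p 1))

  to : IsLabelledForest n p s (glued r c) → IsLabelledForest (n + 1) (p + 1) r (separated r c)
  to i = record
    { roots-are  = trans roots (trans (cong (_∷ʳ just r) (roots-are i)) (sym (map-just-[1⋯]-suc s)))
    ; #vertices  = trans (sym (Vertices.μ-cut r c)) (cong (_+ 1) (#vertices i))
    ; #leaves    = trans (sym (Leaves.μ-cut r c)) (cong (_+ 1) (#leaves i))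
    ; labels-are = ↭-trans (↭-sym same-labels) (↭-trans (labels-are i) (↭-reflexive (sym range)))
    }

  from : IsLabelledForest (n + 1) (p + 1) r (separated r c) → IsLabelledForest n p s (glued r c)
  from i = record
    { roots-are  = ∷ʳ-injectiveˡ _ _
        (trans (sym roots) (trans (roots-are i) (map-just-[1⋯]-suc s)))
    ; #vertices  = +-cancelʳ-≡ 1 _ _ (trans (Vertices.μ-cut r c) (#vertices i))
    ; #leaves    = +-cancelʳ-≡ 1 _ _ (trans (Leaves.μ-cut r c) (#leaves i))
    ; labels-are = ↭-trans same-labels (↭-trans (labels-are i) (↭-reflexive range))
    }

separated-roots : ∀ r c → map root (plugᶠ (position c) leaf) ≡ map root (glued r c) →
  map root (separated r c) ≡ map root (glued r c) ∷ʳ just r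
separated-roots r (plain C cs) eq =
  trans (map-++ root (plugᶠ C leaf) _) (cong (_∷ʳ just r) eq)
separated-roots r (swapped C cs F) _ = map-++ root (node 1 cs ∷ F) _

module _ {n p s : ℕ} where

  private
    r = suc s

  glue-labelled : ∀ c → IsLabelledForest (n + 1) (p + 1) r (separated r c) →
    IsLabelledForest n p s (glued r c)
  glue-labelled c i =
    Equivalence.from (IsLabelledForest-cut {c = c} (separated-roots r c (hole-roots c i))) i
    where
    hole-roots : ∀ c → IsLabelledForest (n + 1) (p + 1) r (separated r c) →
      map root (plugᶠ (position c) leaf) ≡ map root (glued r c)
    hole-roots (swapped _ _ _) i = refl
    hole-roots (plain C cs) i with plugᶠ-roots C
    ... | inj₁ same = same leaf (node r cs)
    ... | inj₂ root∈ = contradiction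
      (subst (nothing ∈_)
        (∷ʳ-injectiveˡ _ _ (trans (sym (map-++ root (plugᶠ C leaf) _))
          (trans (IsLabelledForest.roots-are i) (map-just-[1⋯]-suc s))))
        (root∈ leaf))
      nothing∉justs

  separate-labelled : ∀ c → IsLabelledForest n p s (glued r c) →
    IsLabelledForest (n + 1) (p + 1) r (separated r c)
  separate-labelled c i with plugᶠ-roots (position c)
  ... | inj₁ same = Equivalence.to
    (IsLabelledForest-cut {c = c} (separated-roots r c (same leaf (node r (subtrees c))))) i
  ... | inj₂ root∈ = contradiction
    (subst (just r ∈_) (IsLabelledForest.roots-are i) (root∈ (node r (subtrees c))))
    (just∉[1⋯] s)

-- The bijection with marked forests.

module _ {n p s m : ℕ} where

  private
    r = suc (suc s)

    Glued : Forest → Set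
    Glued = IsLabelledForest[ m ≺1] n p (suc s)

    Separated : Forest → Set
    Separated = IsLabelledForest[ m ≺1] (n + 1) (p + 1) r

    Marked : Forest × ℕ → Set
    Marked (F , i) = Separated F × i < p + 1

    marked : Cut → Forest × ℕ
    marked c = separated r c , mark c

  module _ (r<m : r < m) (m≤n∸p : m ≤ n ∸ p) where

    m≢1 : m ≢ 1
    m≢1 refl = contradiction r<m λ { (s≤s ()) }

    glue-sound : ∀ {c} → Separated (separated r c) → Glued (glued r c)
    glue-sound {c} (i , lies) =
      glue-labelled c i ,
      Equivalence.to (∈₁⇔liesInTreeRootedAt1 (IsLabelledForest.roots-are (glue-labelled c i)))
        (∈₁-glued c (Equivalence.from (∈₁⇔liesInTreeRootedAt1 (IsLabelledForest.roots-are i)) lies))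
      where
      ∈₁-glued : ∀ c → m ∈₁ separated r c → m ∈₁ glued r c
      ∈₁-glued (plain C cs) m∈ = plugᶠ-∈₁ C _ m∈
      ∈₁-glued (swapped C cs F) (here refl) = here refl
      ∈₁-glued (swapped C cs F) (there m∈) = there
        (∈-resp-↭ (↭-sym (labelsᶠ-plug C (node r cs)))
          (∈-++⁺ʳ (labelsᶠ (plugᶠ C leaf)) (there m∈)))

    marked-cut : ∀ c → IsLabelledForest n p (suc s) (glued r c) → m ∈₁ separated r c →
      Marked (marked c)
    marked-cut c i m∈ =
      (i′ , Equivalence.to (∈₁⇔liesInTreeRootedAt1 (IsLabelledForest.roots-are i′)) m∈) ,
      subst (mark c <_) (IsLabelledForest.#leaves i′) (mark<leaves r c)
      where
      i′ = separate-labelled c i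

    -- The vertex `r` exists because `r < m ≤ n ∸ p`. The cut there is plain unless `m` lies below
    -- `r`, in which case swapping returns `m` to the tree of `1`.
    glued-surjective : ∀ {F} → Glued F → ∃ λ c → Marked (marked c) × glued r c ≡ F
    glued-surjective {F} (i , lies)
      with vertexAtᶠ F (∈-resp-↭ (↭-sym (IsLabelledForest.labels-are i))
             (∈-[1⋯] (s≤s z≤n) (≤-trans (<⇒≤ r<m) m≤n∸p)))
         | Equivalence.from (∈₁⇔liesInTreeRootedAt1 {m} (IsLabelledForest.roots-are i)) lies
    ... | there t C , cs , refl | m∈ =
      plain (there t C) cs , marked-cut (plain (there t C) cs) i m∈ , refl
    -- Here `r` would be the first root, but that root is `1` and `r` is at least 2.
    ... | here □ G , cs , refl | m∈ =
      contradiction (proj₁ (∷-injective (IsLabelledForest.roots-are i))) λ ()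
    ... | here (node x C) G , cs , refl | m∈
      with just-injective (proj₁ (∷-injective (IsLabelledForest.roots-are i)))
         | ∈-++⁻ (labels (plug (node x C) leaf))
             (∈-resp-↭ (labels-plug (node x C) (node r cs)) m∈)
    ...   | refl | inj₁ m∈C =
      plain (here (node 1 C) G) cs , marked-cut (plain (here (node 1 C) G) cs) i m∈C , refl
    ...   | refl | inj₂ (here refl) = contradiction r<m (n≮n r)
    ...   | refl | inj₂ (there m∈cs) =
      swapped C cs G , marked-cut (swapped C cs G) i (there m∈cs) , refl

    -- At one position, a plain cut keeps `m` with `1` only if `m` is outside `cs`, a swapped cut
    -- only if `m` is in `cs`; distinct labels forbid both. The label `1` itself occurs on both
    -- sides, hence the appeal to `m≢1`.
    plain-swapped-disjoint : ∀ C cs F → Unique (labelsᶠ (glued r (swapped C cs F))) →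
      m ∈ labels (plug (node 1 C) leaf) → m ∉ labels (node 1 cs)
    plain-swapped-disjoint C cs F u m∈C (here m≡1)   = m≢1 m≡1
    plain-swapped-disjoint C cs F u m∈C (there m∈cs) = proj₂ (proj₂ (Unique-++⁻ _
      (Unique-↭ (labels-plug (node 1 C) (node r cs)) (proj₁ (Unique-++⁻ _ u))))) m∈C (there m∈cs)

    position-injective : ∀ c c′ → Unique (labelsᶠ (glued r c)) →
      m ∈₁ separated r c → m ∈₁ separated r c′ →
      position c ≡ position c′ → subtrees c ≡ subtrees c′ → c ≡ c′
    position-injective (plain _ _) (plain _ _) _ _ _ refl refl = refl
    position-injective (plain _ cs) (swapped C _ F) u m∈ m∈′ refl refl =
      contradiction m∈′ (plain-swapped-disjoint C cs F u m∈)
    position-injective (swapped C cs F) (plain _ _) u m∈ m∈′ refl refl =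
      contradiction m∈ (plain-swapped-disjoint C cs F u m∈′)
    position-injective (swapped _ _ _) (swapped _ _ _) _ _ _ refl refl = refl

    glued-injective : ∀ {c c′} → Marked (marked c) → Marked (marked c′) →
      glued r c ≡ glued r c′ → c ≡ c′
    glued-injective {c} {c′} ((i , lies) , _) ((i′ , lies′) , _) eq
      with Unique-↭ (↭-sym (IsLabelledForest.labels-are (glue-labelled c i))) ([1⋯]-unique (n ∸ p))
    ... | unique with plugᶠ-injective (position c) (position c′) unique eq
    ...   | positions≡ , subtrees≡ = position-injective c c′ unique
      (Equivalence.from (∈₁⇔liesInTreeRootedAt1 (IsLabelledForest.roots-are i)) lies)
      (Equivalence.from (∈₁⇔liesInTreeRootedAt1 (IsLabelledForest.roots-are i′)) lies′)
      positions≡ subtrees≡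

    marked-surjective : ∀ {b} → Marked b → ∃ λ c → marked c ≡ b
    marked-surjective {F , i} ((isF , _) , i<)
      with separated-surjective (IsLabelledForest.roots-are isF)
             (subst (i <_) (sym (IsLabelledForest.#leaves isF)) i<)
    ... | c , refl , refl = c , refl

    glued↔marked : Refinement Forest Glued ↔ Refinement (Forest × ℕ) Marked
    glued↔marked = span-↔
      (isLabelledForest[ m ≺1]? n p (suc s))
      (λ (F , i) → isLabelledForest[ m ≺1]? (n + 1) (p + 1) r F ×-dec i <? p + 1)
      (glued r) marked
      (λ {c} (q , _) → glue-sound {c} q)
      glued-surjective marked-surjective glued-injective
      (λ eq → separated-injective r (cong proj₁ eq) (cong proj₂ eq))

theorem4p3 : (n p r : ℕ) → 2 ≤ r → r < n ∸ p →
    ∃₂ λ (a b : ℕ) →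
    (𝒫⟨ n , p , r ∸ 1 ⟩[ n ∸ p ≺1] ↔ Fin a) ×
    (𝒫⟨ n + 1 , p + 1 , r ⟩[ n ∸ p ≺1] ↔ Fin b) ×
    a ≡ (p + 1) * b
theorem4p3 n p (suc (suc s)) (s≤s (s≤s z≤n)) r<n∸p
  with labelledForests-finite (n ∸ p) (n + 1) (p + 1) (suc (suc s))
... | b , separated↔b =
  -- With `a` chosen as this product, the equation is `refl`; the content is the bijection with
  -- `Fin (p + 1) × Fin b`, taken at `m = n ∸ p`.
  (p + 1) * b , b ,
  ↔-sym *↔× ↔-∘ ((↔-id _ ×-↔ separated↔b) ↔-∘
    (bounded-pair ↔-∘ (glued↔marked r<n∸p ≤-refl ↔-∘ flatten))) ,
  separated↔b ↔-∘ flatten ,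
  refl
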